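{- Let $(N,S)$ be any one of the four pairs $(\mathrm{nC},\mathrm{sC})$, $(\mathrm{nC3},\mathrm{sC3})$, $(\mathrm{nMC},\mathrm{sMC}^*)$, $(\mathrm{nCN},\mathrm{sCN}^*)$ consisting of a natural deduction system and a sequent calculus. For every formula $\alpha$, the sequent $\;\Rightarrow\alpha$ (with empty antecedent) is provable in $S$ if and only if $\alpha$ is provable in $N$.
   Context: Formulas are built from countably many propositional variables $p,q,\dots$ using the binary connectives $\land,\lor,\to$ and the unary connective $\sim$. SEQUENT CALCULI. A sequent is an expression $\Gamma\Rightarrow\gamma$ with $\Gamma$ a finite (possibly empty) set of formulas and $\gamma$ a single formula; $\alpha,\Gamma$ means $\{\alpha\}\cup\Gamma$ and $\Gamma,\Delta$ means $\Gamma\cup\Delta$. The calculus $\mathrm{sC}$ has the following initial sequents and rules ($p$ any propositional variable; $\alpha,\beta,\gamma$ any formulas; $\Gamma,\Delta,\Sigma$ any finite sets of formulas). Initial sequents: (init1) $p,\Gamma\Rightarrow p$; (init2) $\sim p,\Gamma\Rightarrow\sim p$. (cut): from $\Gamma\Rightarrow\alpha$ and $\alpha,\Sigma\Rightarrow\gamma$ infer $\Gamma,\Sigma\Rightarrow\gamma$. ($\to$left): from $\Gamma\Rightarrow\alpha$ and $\beta,\Delta\Rightarrow\gamma$ infer $\alpha\to\beta,\Gamma,\Delta\Rightarrow\gamma$. ($\to$right): from $\alpha,\Gamma\Rightarrow\beta$ infer $\Gamma\Rightarrow\alpha\to\beta$. ($\land$left): from $\alpha,\beta,\Gamma\Rightarrow\gamma$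 infer $\alpha\land\beta,\Gamma\Rightarrow\gamma$. ($\land$right): from $\Gamma\Rightarrow\alpha$ and $\Gamma\Rightarrow\beta$ infer $\Gamma\Rightarrow\alpha\land\beta$. ($\lor$left): from $\alpha,\Gamma\Rightarrow\gamma$ and $\beta,\Gamma\Rightarrow\gamma$ infer $\alpha\lor\beta,\Gamma\Rightarrow\gamma$. ($\lor$right1), ($\lor$right2): from $\Gamma\Rightarrow\alpha$ (respectively $\Gamma\Rightarrow\beta$) infer $\Gamma\Rightarrow\alpha\lor\beta$. ($\sim$left): from $\alpha,\Gamma\Rightarrow\gamma$ infer $\sim\sim\alpha,\Gamma\Rightarrow\gamma$. ($\sim$right): from $\Gamma\Rightarrow\alpha$ infer $\Gamma\Rightarrow\sim\sim\alpha$. ($\sim\to$left): from $\Gamma\Rightarrow\alpha$ and $\sim\beta,\Delta\Rightarrow\gamma$ infer $\sim(\alpha\to\beta),\Gamma,\Delta\Rightarrow\gamma$. ($\sim\to$right): from $\alpha,\Gamma\Rightarrow\sim\beta$ infer $\Gamma\Rightarrow\sim(\alpha\to\beta)$. ($\sim\land$left): from $\sim\alpha,\Gamma\Rightarrow\gamma$ and $\sim\beta,\Gamma\Rightarrow\gamma$ infer $\sim(\alpha\land\beta),\Gamma\Rightarrow\gamma$. ($\sim\land$right1), ($\sim\land$right2): from $\Gamma\Rightarrow\sim\alpha$ (respectively $\Gamma\Rightarrow\sim\beta$) infer $\Gamma\Rightarrow\sim(\alpha\land\beta)$. ($\sim\lor$left): from $\sim\alpha,\sim\beta,\Gamma\Rightarrow\gamma$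 infer $\sim(\alpha\lor\beta),\Gamma\Rightarrow\gamma$. ($\sim\lor$right): from $\Gamma\Rightarrow\sim\alpha$ and $\Gamma\Rightarrow\sim\beta$ infer $\Gamma\Rightarrow\sim(\alpha\lor\beta)$. Additional rules: (ex-middle): from $\sim\alpha,\Gamma\Rightarrow\gamma$ and $\alpha,\Gamma\Rightarrow\gamma$ infer $\Gamma\Rightarrow\gamma$. (g-ex-middle): from $\alpha\to\beta,\Gamma\Rightarrow\gamma$ and $\alpha,\Gamma\Rightarrow\gamma$ infer $\Gamma\Rightarrow\gamma$. $\mathrm{sC3}=\mathrm{sC}+$(ex-middle); $\mathrm{sMC}^*=\mathrm{sC}+$(g-ex-middle); $\mathrm{sCN}^*=\mathrm{sC3}+$(g-ex-middle). NATURAL DEDUCTION SYSTEMS. Derivations are Gentzen-style trees; a single assumption $\alpha$ is a derivation of $\alpha$ from itself. $[\alpha]$ marks assumptions discharged by a rule; a rule may discharge zero or more occurrences of the indicated assumption (vacuous discharge allowed). The rules of $\mathrm{nC}$ are: ($\to$I): from a derivation of $\beta$ from $[\alpha]$, infer $\alpha\to\beta$. ($\to$E): from $\alpha\to\beta$ and $\alpha$ infer $\beta$. ($\land$I): from $\alpha$ and $\beta$ infer $\alpha\land\beta$. ($\land$E1), ($\land$E2): from $\alpha\land\beta$ infer $\alpha$ (respectively $\beta$). ($\lor$I1), ($\lor$I2): from $\alpha$ (respectively $\beta$) infer $\alpha\lor\beta$. ($\lor$E): from $\alpha\lor\beta$, a derivation of $\gamma$ from $[\alpha]$, and a derivation of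 $\gamma$ from $[\beta]$, infer $\gamma$. ($\sim\sim$I): from $\alpha$ infer $\sim\sim\alpha$. ($\sim\sim$E): from $\sim\sim\alpha$ infer $\alpha$. ($\sim\to$I): from a derivation of $\sim\beta$ from $[\alpha]$, infer $\sim(\alpha\to\beta)$. ($\sim\to$E): from $\sim(\alpha\to\beta)$ and $\alpha$ infer $\sim\beta$. ($\sim\land$I1), ($\sim\land$I2): from $\sim\alpha$ (respectively $\sim\beta$) infer $\sim(\alpha\land\beta)$. ($\sim\land$E): from $\sim(\alpha\land\beta)$, a derivation of $\gamma$ from $[\sim\alpha]$, and a derivation of $\gamma$ from $[\sim\beta]$, infer $\gamma$. ($\sim\lor$I): from $\sim\alpha$ and $\sim\beta$ infer $\sim(\alpha\lor\beta)$. ($\sim\lor$E1), ($\sim\lor$E2): from $\sim(\alpha\lor\beta)$ infer $\sim\alpha$ (respectively $\sim\beta$). Additional rules: (EM): from a derivation of $\gamma$ from $[\sim\alpha]$ and a derivation of $\gamma$ from $[\alpha]$, infer $\gamma$. (GEM): from a derivation of $\gamma$ from $[\alpha\to\beta]$ and a derivation of $\gamma$ from $[\alpha]$, infer $\gamma$. $\mathrm{nC3}=\mathrm{nC}+$(EM); $\mathrm{nMC}=\mathrm{nC}+$(GEM); $\mathrm{nCN}=\mathrm{nC3}+$(GEM). A formula $\alpha$ is provable in a natural deduction system $N$ if there is a derivation in $N$ with no open (undischarged) assumptions whose end-formula is $\alpha$. -}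

module Defs where

open import Data.List.Base using (List; []; _∷_; [_]; _++_)
open import Data.List.Relation.Binary.BagAndSetEquality using (_∼[_]_; set)
open import Data.Nat.Base using (ℕ)

infix  9 ~_
infixr 8 _∧_
infixr 7 _∨_
infixr 6 _⊃_

-- _⊃_ is the object-level implication.
data Formula : Set where
  var         : ℕ → Formula
  _∧_ _∨_ _⊃_ : Formula → Formula → Formula
  ~_          : Formula → Formula

private variable
  p                       : ℕ
  α β γ                   : Formula
  Γ Δ Σ Γ₁ Γ₂ Δ₁ Δ₂       : List Formula

data SequentCalculus : Set where
  sC sC3 sMC* sCN* : SequentCalculus

data HasExMiddle : SequentCalculus → Set where
  sC3  : HasExMiddle sC3
  sCN* : HasExMiddle sCN*

data HasGExMiddle : SequentCalculus → Set where
  sMC* : HasGExMiddle sMC*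
  sCN* : HasGExMiddle sCN*

-- S ⊢ Γ ⇒ γ: the sequent Γ ⇒ γ is provable in S.  The antecedent is a finite
-- set of formulas, represented by a list that enumerates it; the constructor
-- set-eq identifies lists with the same members, so that contraction and
-- exchange are built in, while weakening is not.
infix 4 _⊢_⇒_
data _⊢_⇒_ (S : SequentCalculus) : List Formula → Formula → Set where
  set-eq      : Γ ∼[ set ] Δ → S ⊢ Γ ⇒ γ → S ⊢ Δ ⇒ γ

  init1       : S ⊢ var p ∷ Γ ⇒ var p
  init2       : S ⊢ ~ var p ∷ Γ ⇒ ~ var p
  cut         : S ⊢ Γ ⇒ α → S ⊢ α ∷ Σ ⇒ γ → S ⊢ Γ ++ Σ ⇒ γ

  ⊃-left      : S ⊢ Γ ⇒ α → S ⊢ β ∷ Δ ⇒ γ → S ⊢ α ⊃ β ∷ Γ ++ Δ ⇒ γ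
  ⊃-right     : S ⊢ α ∷ Γ ⇒ β → S ⊢ Γ ⇒ α ⊃ β
  ∧-left      : S ⊢ α ∷ β ∷ Γ ⇒ γ → S ⊢ α ∧ β ∷ Γ ⇒ γ
  ∧-right     : S ⊢ Γ ⇒ α → S ⊢ Γ ⇒ β → S ⊢ Γ ⇒ α ∧ β
  ∨-left      : S ⊢ α ∷ Γ ⇒ γ → S ⊢ β ∷ Γ ⇒ γ → S ⊢ α ∨ β ∷ Γ ⇒ γ
  ∨-right1    : S ⊢ Γ ⇒ α → S ⊢ Γ ⇒ α ∨ β
  ∨-right2    : S ⊢ Γ ⇒ β → S ⊢ Γ ⇒ α ∨ β

  ~-left      : S ⊢ α ∷ Γ ⇒ γ → S ⊢ ~ ~ α ∷ Γ ⇒ γ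
  ~-right     : S ⊢ Γ ⇒ α → S ⊢ Γ ⇒ ~ ~ α
  ~⊃-left     : S ⊢ Γ ⇒ α → S ⊢ ~ β ∷ Δ ⇒ γ → S ⊢ ~ (α ⊃ β) ∷ Γ ++ Δ ⇒ γ
  ~⊃-right    : S ⊢ α ∷ Γ ⇒ ~ β → S ⊢ Γ ⇒ ~ (α ⊃ β)
  ~∧-left     : S ⊢ ~ α ∷ Γ ⇒ γ → S ⊢ ~ β ∷ Γ ⇒ γ → S ⊢ ~ (α ∧ β) ∷ Γ ⇒ γ
  ~∧-right1   : S ⊢ Γ ⇒ ~ α → S ⊢ Γ ⇒ ~ (α ∧ β)
  ~∧-right2   : S ⊢ Γ ⇒ ~ β → S ⊢ Γ ⇒ ~ (α ∧ β)
  ~∨-left     : S ⊢ ~ α ∷ ~ β ∷ Γ ⇒ γ → S ⊢ ~ (α ∨ β) ∷ Γ ⇒ γ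
  ~∨-right    : S ⊢ Γ ⇒ ~ α → S ⊢ Γ ⇒ ~ β → S ⊢ Γ ⇒ ~ (α ∨ β)

  ex-middle   : HasExMiddle S →
                S ⊢ ~ α ∷ Γ ⇒ γ → S ⊢ α ∷ Γ ⇒ γ → S ⊢ Γ ⇒ γ
  g-ex-middle : HasGExMiddle S →
                S ⊢ α ⊃ β ∷ Γ ⇒ γ → S ⊢ α ∷ Γ ⇒ γ → S ⊢ Γ ⇒ γ

data NaturalDeduction : Set where
  nC nC3 nMC nCN : NaturalDeduction

data HasEM : NaturalDeduction → Set where
  nC3 : HasEM nC3
  nCN : HasEM nCN

data HasGEM : NaturalDeduction → Set where
  nMC : HasGEM nMC
  nCN : HasGEM nCN

-- Discharge α Γ Δ: deleting zero or more chosen occurrences of α from Γ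
-- leaves Δ.
data Discharge (α : Formula) : List Formula → List Formula → Set where
  []   : Discharge α [] []
  drop : Discharge α Γ Δ → Discharge α (α ∷ Γ) Δ
  keep : Discharge α Γ Δ → Discharge α (β ∷ Γ) (β ∷ Δ)

-- Derivation N Γ α: derivation trees in N with end-formula α, where Γ lists
-- exactly the occurrences of open assumptions at the leaves, from left to
-- right.
data Derivation (N : NaturalDeduction) : List Formula → Formula → Set where
  assume : Derivation N [ α ] α

  ⊃I     : Derivation N Γ β → Discharge α Γ Δ → Derivation N Δ (α ⊃ β)
  ⊃E     : Derivation N Γ (α ⊃ β) → Derivation N Δ α →
           Derivation N (Γ ++ Δ) β
  ∧I     : Derivation N Γ α → Derivation N Δ β → Derivation N (Γ ++ Δ) (α ∧ β)
  ∧E1    : Derivation N Γ (α ∧ β) → Derivation N Γ α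
  ∧E2    : Derivation N Γ (α ∧ β) → Derivation N Γ β
  ∨I1    : Derivation N Γ α → Derivation N Γ (α ∨ β)
  ∨I2    : Derivation N Γ β → Derivation N Γ (α ∨ β)
  ∨E     : Derivation N Γ (α ∨ β) →
           Derivation N Γ₁ γ → Discharge α Γ₁ Δ₁ →
           Derivation N Γ₂ γ → Discharge β Γ₂ Δ₂ →
           Derivation N (Γ ++ Δ₁ ++ Δ₂) γ

  ~~I    : Derivation N Γ α → Derivation N Γ (~ ~ α)
  ~~E    : Derivation N Γ (~ ~ α) → Derivation N Γ α
  ~⊃I    : Derivation N Γ (~ β) → Discharge α Γ Δ →
           Derivation N Δ (~ (α ⊃ β))
  ~⊃E    : Derivation N Γ (~ (α ⊃ β)) → Derivation N Δ α →
           Derivation N (Γ ++ Δ) (~ β)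
  ~∧I1   : Derivation N Γ (~ α) → Derivation N Γ (~ (α ∧ β))
  ~∧I2   : Derivation N Γ (~ β) → Derivation N Γ (~ (α ∧ β))
  ~∧E    : Derivation N Γ (~ (α ∧ β)) →
           Derivation N Γ₁ γ → Discharge (~ α) Γ₁ Δ₁ →
           Derivation N Γ₂ γ → Discharge (~ β) Γ₂ Δ₂ →
           Derivation N (Γ ++ Δ₁ ++ Δ₂) γ
  ~∨I    : Derivation N Γ (~ α) → Derivation N Δ (~ β) →
           Derivation N (Γ ++ Δ) (~ (α ∨ β))
  ~∨E1   : Derivation N Γ (~ (α ∨ β)) → Derivation N Γ (~ α)
  ~∨E2   : Derivation N Γ (~ (α ∨ β)) → Derivation N Γ (~ β)

  EM     : HasEM N →
           Derivation N Γ₁ γ → Discharge (~ α) Γ₁ Δ₁ →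
           Derivation N Γ₂ γ → Discharge α Γ₂ Δ₂ →
           Derivation N (Δ₁ ++ Δ₂) γ
  GEM    : HasGEM N →
           Derivation N Γ₁ γ → Discharge (α ⊃ β) Γ₁ Δ₁ →
           Derivation N Γ₂ γ → Discharge α Γ₂ Δ₂ →
           Derivation N (Δ₁ ++ Δ₂) γ

Provable : NaturalDeduction → Formula → Set
Provable N α = Derivation N [] α

data Pair : NaturalDeduction → SequentCalculus → Set where
  nC-sC    : Pair nC  sC
  nC3-sC3  : Pair nC3 sC3
  nMC-sMC* : Pair nMC sMC*
  nCN-sCN* : Pair nCN sCN*

{-# OPTIONS --safe #-}
-- Sequents and derivations are matched over shared contexts: a derivation
-- whose open assumptions lie in a finite set Θ yields Θ ⇒ γ and conversely.
-- An elimination rule becomes a cut against the corresponding left rule applied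
-- to identity sequents, and a left rule becomes an elimination rule applied to
-- the principal formula; cut itself is simulated by ⊃I followed by ⊃E.

module Submission where

open import Defs
open import Data.List.Base using (List; []; _∷_; [_]; _++_)
open import Data.List.Membership.Propositional using (_∈_)
open import Data.List.Membership.Propositional.Properties using (∈-++⁺ˡ; ∈-++⁺ʳ; ∈-++⁻)
open import Data.List.Relation.Binary.Subset.Propositional using (_⊆_)
open import Data.List.Relation.Binary.Subset.Propositional.Properties
  using (∷⁺ʳ; xs⊆xs++ys; xs⊆ys++xs)
open import Data.List.Relation.Unary.Any using (here; there)
open import Data.Product using (∃; _×_; _,_)
open import Data.Sum using ([_,_]′)
open import Function.Base using (id; _∘_)
open import Function.Bundles using (_⇔_; mk⇔; Equivalence)
open import Relation.Binary.PropositionalEquality using (refl)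

private variable
  N               : NaturalDeduction
  S               : SequentCalculus
  α β γ δ         : Formula
  Γ Δ Θ           : List Formula

++-least : Γ ⊆ Θ → Δ ⊆ Θ → Γ ++ Δ ⊆ Θ
++-least {Γ = Γ} Γ⊆Θ Δ⊆Θ = [ Γ⊆Θ , Δ⊆Θ ]′ ∘ ∈-++⁻ Γ

swap : α ∷ β ∷ Γ ⊆ β ∷ α ∷ Γ
swap (here eq)         = there (here eq)
swap (there (here eq)) = here eq
swap (there (there i)) = there (there i)

reorder : Γ ⊆ Δ → Δ ⊆ Γ → S ⊢ Γ ⇒ γ → S ⊢ Δ ⇒ γ
reorder Γ⊆Δ Δ⊆Γ = set-eq (mk⇔ Γ⊆Δ Δ⊆Γ)

exchange : S ⊢ α ∷ β ∷ Γ ⇒ γ → S ⊢ β ∷ α ∷ Γ ⇒ γ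
exchange = reorder swap swap

-- Repetition does not change the set a list enumerates, so `set-eq` absorbs it. Rules that join two
-- antecedents can thus be used over one common antecedent.
contract-++ : S ⊢ Γ ++ Γ ⇒ γ → S ⊢ Γ ⇒ γ
contract-++ {Γ = Γ} = reorder (++-least id id) (xs⊆xs++ys Γ Γ)

contract-∷++ : S ⊢ α ∷ Γ ++ Γ ⇒ γ → S ⊢ α ∷ Γ ⇒ γ
contract-∷++ {α = α} {Γ = Γ} =
  reorder (∷⁺ʳ α (++-least id id)) (∷⁺ʳ α (xs⊆xs++ys Γ Γ))

⊃-left-shared : S ⊢ Γ ⇒ α → S ⊢ β ∷ Γ ⇒ γ → S ⊢ α ⊃ β ∷ Γ ⇒ γ
⊃-left-shared d e = contract-∷++ (⊃-left d e)

~⊃-left-shared : S ⊢ Γ ⇒ α → S ⊢ ~ β ∷ Γ ⇒ γ → S ⊢ ~ (α ⊃ β) ∷ Γ ⇒ γ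
~⊃-left-shared d e = contract-∷++ (~⊃-left d e)

cut-shared : S ⊢ Γ ⇒ α → S ⊢ α ∷ Γ ⇒ γ → S ⊢ Γ ⇒ γ
cut-shared d e = contract-++ (cut d e)

-- Initial sequents cover only variables and negated variables. A negation is decomposed by the
-- shape of the formula beneath it, hence the mutual induction. The free side context `Γ` is what
-- later yields weakening.
identity  : ∀ α → S ⊢ α ∷ Γ ⇒ α
identity~ : ∀ α → S ⊢ ~ α ∷ Γ ⇒ ~ α

identity (var p) = init1
identity (α ∧ β) = ∧-left (∧-right (identity α) (exchange (identity β)))
identity (α ∨ β) = ∨-left (∨-right1 (identity α)) (∨-right2 (identity β))
identity (α ⊃ β) =
  ⊃-right (exchange (⊃-left-shared (identity α) (identity β)))
identity (~ α)   = identity~ α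

identity~ (var p) = init2
identity~ (α ∧ β) =
  ~∧-left (~∧-right1 (identity~ α)) (~∧-right2 (identity~ β))
identity~ (α ∨ β) =
  ~∨-left (~∨-right (identity~ α) (exchange (identity~ β)))
identity~ (α ⊃ β) =
  ~⊃-right (exchange (~⊃-left-shared (identity α) (identity~ β)))
identity~ (~ α)   = ~-left (~-right (identity α))

-- Weakening is not primitive, but a cut against γ, Δ ⇒ γ with arbitrary Δ gives it.
weaken : Γ ⊆ Δ → S ⊢ Γ ⇒ γ → S ⊢ Δ ⇒ γ
weaken {Γ = Γ} {Δ = Δ} {γ = γ} Γ⊆Δ d =
  reorder (++-least Γ⊆Δ id) (xs⊆ys++xs Δ Γ) (cut d (identity γ))

assumption : α ∈ Γ → S ⊢ Γ ⇒ α
assumption {α = α} α∈Γ = weaken {Γ = [ α ]} (λ { (here refl) → α∈Γ }) (identity α)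

-- Deleted occurrences are sent to the head and surviving ones into `Θ`. Letting `Θ` exceed `Δ`
-- keeps it fixed when the recursion passes a `keep`.
Discharge⇒⊆ : Discharge α Γ Δ → Δ ⊆ Θ → Γ ⊆ α ∷ Θ
Discharge⇒⊆ (drop d) Δ⊆Θ (here eq) = here eq
Discharge⇒⊆ (drop d) Δ⊆Θ (there i) = Discharge⇒⊆ d Δ⊆Θ i
Discharge⇒⊆ (keep d) Δ⊆Θ (here eq) = there (Δ⊆Θ (here eq))
Discharge⇒⊆ (keep d) Δ⊆Θ (there i) = Discharge⇒⊆ d (Δ⊆Θ ∘ there) i

HasEM⇒HasExMiddle : Pair N S → HasEM N → HasExMiddle S
HasEM⇒HasExMiddle nC3-sC3  nC3 = sC3
HasEM⇒HasExMiddle nCN-sCN* nCN = sCN*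

HasGEM⇒HasGExMiddle : Pair N S → HasGEM N → HasGExMiddle S
HasGEM⇒HasGExMiddle nMC-sMC* nMC = sMC*
HasGEM⇒HasGExMiddle nCN-sCN* nCN = sCN*

HasExMiddle⇒HasEM : Pair N S → HasExMiddle S → HasEM N
HasExMiddle⇒HasEM nC3-sC3  sC3  = nC3
HasExMiddle⇒HasEM nCN-sCN* sCN* = nCN

HasGExMiddle⇒HasGEM : Pair N S → HasGExMiddle S → HasGEM N
HasGExMiddle⇒HasGEM nMC-sMC* sMC* = nMC
HasGExMiddle⇒HasGEM nCN-sCN* sCN* = nCN

-- An arbitrary `Θ` containing the open assumptions lets all premises of a rule be translated over
-- the same antecedent, although their own assumption lists differ.
Derivation⇒⊢ : Pair N S → Derivation N Γ γ → Γ ⊆ Θ → S ⊢ Θ ⇒ γ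
Derivation⇒⊢ {N} {S} pair = go
  where
  ⊆ˡ : ∀ {Δ} → Γ ++ Δ ⊆ Θ → Γ ⊆ Θ
  ⊆ˡ s = s ∘ ∈-++⁺ˡ

  ⊆ʳ : ∀ Γ {Δ} → Γ ++ Δ ⊆ Θ → Δ ⊆ Θ
  ⊆ʳ Γ s = s ∘ ∈-++⁺ʳ Γ

  go : Derivation N Γ γ → Γ ⊆ Θ → S ⊢ Θ ⇒ γ
  go assume s = assumption (s (here refl))
  go (⊃I d x) s = ⊃-right (go d (Discharge⇒⊆ x s))
  go (⊃E {Γ = Γ} d e) s =
    cut-shared (go d (⊆ˡ s)) (⊃-left-shared (go e (⊆ʳ Γ s)) (identity _))
  go (∧I {Γ = Γ} d e) s = ∧-right (go d (⊆ˡ s)) (go e (⊆ʳ Γ s))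
  go (∧E1 d) s = cut-shared (go d s) (∧-left (identity _))
  go (∧E2 d) s = cut-shared (go d s) (∧-left (exchange (identity _)))
  go (∨I1 d) s = ∨-right1 (go d s)
  go (∨I2 d) s = ∨-right2 (go d s)
  go (∨E {Γ = Γ} {Δ₁ = Δ₁} d e x f y) s =
    cut-shared (go d (⊆ˡ s))
      (∨-left (go e (Discharge⇒⊆ x (⊆ˡ (⊆ʳ Γ s))))
              (go f (Discharge⇒⊆ y (⊆ʳ Δ₁ (⊆ʳ Γ s)))))
  go (~~I d) s = ~-right (go d s)
  go (~~E d) s = cut-shared (go d s) (~-left (identity _))
  go (~⊃I d x) s = ~⊃-right (go d (Discharge⇒⊆ x s))
  go (~⊃E {Γ = Γ} d e) s =
    cut-shared (go d (⊆ˡ s)) (~⊃-left-shared (go e (⊆ʳ Γ s)) (identity _))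
  go (~∧I1 d) s = ~∧-right1 (go d s)
  go (~∧I2 d) s = ~∧-right2 (go d s)
  go (~∧E {Γ = Γ} {Δ₁ = Δ₁} d e x f y) s =
    cut-shared (go d (⊆ˡ s))
      (~∧-left (go e (Discharge⇒⊆ x (⊆ˡ (⊆ʳ Γ s))))
               (go f (Discharge⇒⊆ y (⊆ʳ Δ₁ (⊆ʳ Γ s)))))
  go (~∨I {Γ = Γ} d e) s = ~∨-right (go d (⊆ˡ s)) (go e (⊆ʳ Γ s))
  go (~∨E1 d) s = cut-shared (go d s) (~∨-left (identity _))
  go (~∨E2 d) s = cut-shared (go d s) (~∨-left (exchange (identity _)))
  go (EM {Δ₁ = Δ₁} h d x e y) s =
    ex-middle (HasEM⇒HasExMiddle pair h)
      (go d (Discharge⇒⊆ x (⊆ˡ s))) (go e (Discharge⇒⊆ y (⊆ʳ Δ₁ s)))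
  go (GEM {Δ₁ = Δ₁} h d x e y) s =
    g-ex-middle (HasGEM⇒HasGExMiddle pair h)
      (go d (Discharge⇒⊆ x (⊆ˡ s))) (go e (Discharge⇒⊆ y (⊆ʳ Δ₁ s)))

-- Derivation records the exact open occurrences; allowing any list with members
-- in Θ turns them into a set-like context that admits weakening.
infix 4 _⊩_⇒_
_⊩_⇒_ : NaturalDeduction → List Formula → Formula → Set
N ⊩ Θ ⇒ γ = ∃ λ Γ → Γ ⊆ Θ × Derivation N Γ γ

-- The inclusion itself chooses what to discharge: an occurrence mapped to the head is dropped, one
-- mapped into `Θ` is kept. No equality test on formulas is involved.
⊆⇒Discharge : ∀ Γ → Γ ⊆ α ∷ Θ → ∃ λ Δ → Discharge α Γ Δ × Δ ⊆ Θ
⊆⇒Discharge [] s = [] , [] , λ ()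
⊆⇒Discharge (β ∷ Γ) s with s (here refl) | ⊆⇒Discharge Γ (s ∘ there)
... | here refl | Δ , x , t = Δ , drop x , t
... | there i   | Δ , x , t = β ∷ Δ , keep x , λ where
  (here refl) → i
  (there j)   → t j

⊩-weaken : Γ ⊆ Δ → N ⊩ Γ ⇒ γ → N ⊩ Δ ⇒ γ
⊩-weaken Γ⊆Δ (Γ′ , s , d) = Γ′ , Γ⊆Δ ∘ s , d

⊩-assume : α ∈ Γ → N ⊩ Γ ⇒ α
⊩-assume {α = α} α∈Γ = [ α ] , (λ { (here refl) → α∈Γ }) , assume

⊩-map : (∀ {Δ} → Derivation N Δ α → Derivation N Δ β) → N ⊩ Γ ⇒ α → N ⊩ Γ ⇒ β
⊩-map f (Γ , s , d) = Γ , s , f d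

⊩-map₂ : (∀ {Δ₁ Δ₂} → Derivation N Δ₁ α → Derivation N Δ₂ β →
          Derivation N (Δ₁ ++ Δ₂) γ) →
         N ⊩ Γ ⇒ α → N ⊩ Γ ⇒ β → N ⊩ Γ ⇒ γ
⊩-map₂ f (Γ , s , d) (Δ , t , e) = Γ ++ Δ , ++-least s t , f d e

⊩-⊃I : N ⊩ α ∷ Γ ⇒ β → N ⊩ Γ ⇒ α ⊃ β
⊩-⊃I (Γ , s , d) with ⊆⇒Discharge Γ s
... | Δ , x , t = Δ , t , ⊃I d x

⊩-~⊃I : N ⊩ α ∷ Γ ⇒ ~ β → N ⊩ Γ ⇒ ~ (α ⊃ β)
⊩-~⊃I (Γ , s , d) with ⊆⇒Discharge Γ s
... | Δ , x , t = Δ , t , ~⊃I d x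

-- The detour through `α ⊃ γ` replaces grafting one tree onto the leaves of another, so no induction
-- on derivations is required.
⊩-cut : N ⊩ Γ ⇒ α → N ⊩ α ∷ Γ ⇒ γ → N ⊩ Γ ⇒ γ
⊩-cut d e = ⊩-map₂ ⊃E (⊩-⊃I e) d

⊩-∨E : N ⊩ Γ ⇒ α ∨ β → N ⊩ α ∷ Γ ⇒ γ → N ⊩ β ∷ Γ ⇒ γ → N ⊩ Γ ⇒ γ
⊩-∨E (_ , s , d) (Γ₁ , s₁ , e) (Γ₂ , s₂ , f)
  with ⊆⇒Discharge Γ₁ s₁ | ⊆⇒Discharge Γ₂ s₂
... | _ , x , t₁ | _ , y , t₂ =
  _ , ++-least s (++-least t₁ t₂) , ∨E d e x f y

⊩-~∧E : N ⊩ Γ ⇒ ~ (α ∧ β) → N ⊩ ~ α ∷ Γ ⇒ γ → N ⊩ ~ β ∷ Γ ⇒ γ → N ⊩ Γ ⇒ γ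
⊩-~∧E (_ , s , d) (Γ₁ , s₁ , e) (Γ₂ , s₂ , f)
  with ⊆⇒Discharge Γ₁ s₁ | ⊆⇒Discharge Γ₂ s₂
... | _ , x , t₁ | _ , y , t₂ =
  _ , ++-least s (++-least t₁ t₂) , ~∧E d e x f y

⊩-EM : HasEM N → N ⊩ ~ α ∷ Γ ⇒ γ → N ⊩ α ∷ Γ ⇒ γ → N ⊩ Γ ⇒ γ
⊩-EM h (Γ₁ , s₁ , d) (Γ₂ , s₂ , e)
  with ⊆⇒Discharge Γ₁ s₁ | ⊆⇒Discharge Γ₂ s₂
... | _ , x , t₁ | _ , y , t₂ = _ , ++-least t₁ t₂ , EM h d x e y

⊩-GEM : HasGEM N → N ⊩ α ⊃ β ∷ Γ ⇒ γ → N ⊩ α ∷ Γ ⇒ γ → N ⊩ Γ ⇒ γ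
⊩-GEM h (Γ₁ , s₁ , d) (Γ₂ , s₂ , e)
  with ⊆⇒Discharge Γ₁ s₁ | ⊆⇒Discharge Γ₂ s₂
... | _ , x , t₁ | _ , y , t₂ = _ , ++-least t₁ t₂ , GEM h d x e y

⊩-left : N ⊩ α ∷ Γ ⇒ β → N ⊩ β ∷ Γ ⇒ γ → N ⊩ α ∷ Γ ⇒ γ
⊩-left {β = β} d e = ⊩-cut d (⊩-weaken (∷⁺ʳ β there) e)

⊩-left₂ : N ⊩ α ∷ Γ ⇒ β → N ⊩ α ∷ Γ ⇒ δ → N ⊩ β ∷ δ ∷ Γ ⇒ γ → N ⊩ α ∷ Γ ⇒ γ
⊩-left₂ {β = β} {δ = δ} d e f =
  -- `δ` is cut outermost, so the derivation of `β` runs with `δ` added to its context.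
  ⊩-cut e (⊩-cut (⊩-weaken there d) (⊩-weaken (∷⁺ʳ β (∷⁺ʳ δ there)) f))

⊩-principal : N ⊩ α ∷ Γ ⇒ α
⊩-principal = ⊩-assume (here refl)

⊢⇒⊩ : Pair N S → S ⊢ Γ ⇒ γ → N ⊩ Γ ⇒ γ
⊢⇒⊩ {N} {S} pair = go
  where
  ∷-++ˡ : ∀ {α Γ Δ} → N ⊩ Γ ⇒ γ → N ⊩ α ∷ Γ ++ Δ ⇒ γ
  ∷-++ˡ = ⊩-weaken (there ∘ ∈-++⁺ˡ)

  ++ʳ : ∀ {α} Γ {Δ} → N ⊩ α ∷ Δ ⇒ γ → N ⊩ α ∷ Γ ++ Δ ⇒ γ
  ++ʳ {α = α} Γ = ⊩-weaken (∷⁺ʳ α (∈-++⁺ʳ Γ))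

  -- Premises of `∨-left` and `~∧-left` need not contain the principal formula, whereas the branches
  -- of the matching elimination are taken over the whole conclusion context; here `β` is that
  -- formula.
  skip : ∀ {α β} → N ⊩ α ∷ Γ ⇒ γ → N ⊩ α ∷ β ∷ Γ ⇒ γ
  skip {α = α} = ⊩-weaken (∷⁺ʳ α there)

  go : S ⊢ Γ ⇒ γ → N ⊩ Γ ⇒ γ
  go (set-eq eq d) = ⊩-weaken (Equivalence.to eq) (go d)
  go init1 = ⊩-principal
  go init2 = ⊩-principal
  go (cut {Γ = Γ} d e) = ⊩-cut (⊩-weaken ∈-++⁺ˡ (go d)) (++ʳ Γ (go e))
  go (⊃-left {Γ = Γ} d e) =
    ⊩-left (⊩-map₂ ⊃E ⊩-principal (∷-++ˡ (go d))) (++ʳ Γ (go e))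
  go (⊃-right d) = ⊩-⊃I (go d)
  go (∧-left d) =
    ⊩-left₂ (⊩-map ∧E1 ⊩-principal) (⊩-map ∧E2 ⊩-principal) (go d)
  go (∧-right d e) = ⊩-map₂ ∧I (go d) (go e)
  go (∨-left d e) = ⊩-∨E ⊩-principal (skip (go d)) (skip (go e))
  go (∨-right1 d) = ⊩-map ∨I1 (go d)
  go (∨-right2 d) = ⊩-map ∨I2 (go d)
  go (~-left d) = ⊩-left (⊩-map ~~E ⊩-principal) (go d)
  go (~-right d) = ⊩-map ~~I (go d)
  go (~⊃-left {Γ = Γ} d e) =
    ⊩-left (⊩-map₂ ~⊃E ⊩-principal (∷-++ˡ (go d))) (++ʳ Γ (go e))
  go (~⊃-right d) = ⊩-~⊃I (go d)
  go (~∧-left d e) = ⊩-~∧E ⊩-principal (skip (go d)) (skip (go e))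
  go (~∧-right1 d) = ⊩-map ~∧I1 (go d)
  go (~∧-right2 d) = ⊩-map ~∧I2 (go d)
  go (~∨-left d) =
    ⊩-left₂ (⊩-map ~∨E1 ⊩-principal) (⊩-map ~∨E2 ⊩-principal) (go d)
  go (~∨-right d e) = ⊩-map₂ ~∨I (go d) (go e)
  go (ex-middle h d e) = ⊩-EM (HasExMiddle⇒HasEM pair h) (go d) (go e)
  go (g-ex-middle h d e) = ⊩-GEM (HasGExMiddle⇒HasGEM pair h) (go d) (go e)

-- A list whose members all lie in `[]` is itself `[]`, so no assumption is open.
⊩[]⇒Provable : N ⊩ [] ⇒ γ → Provable N γ
⊩[]⇒Provable ([]    , _ , d) = d
⊩[]⇒Provable (_ ∷ _ , s , _) with () ← s (here refl)

theorem3p8 : ∀ {N S} → Pair N S → ∀ (α : Formula) → (S ⊢ [] ⇒ α) ⇔ Provable N α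
theorem3p8 pair α = mk⇔ (⊩[]⇒Provable ∘ ⊢⇒⊩ pair) (λ d → Derivation⇒⊢ pair d id)
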